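{- Let $\mathcal{V}=\mathbb{ISP}(\mathcal{C})$ be a coherent variety of residuated lattices such that the class $\mathcal{C}$ is closed under canonical extensions. Then $\mathcal{V}\models(\mathrm{e}\wedge x)^{n+1}\approx(\mathrm{e}\wedge x)^n$ for some $n\in\mathbb{N}$, and if $\mathcal{V}$ is also Hamiltonian, then $\mathcal{V}$ has equationally definable principal congruences (EDPC).
   Context: A residuated lattice is an algebra $\langle A,\wedge,\vee,\cdot,\backslash,/,\mathrm{e}\rangle$ such that $\langle A,\wedge,\vee\rangle$ is a lattice, $\langle A,\cdot,\mathrm{e}\rangle$ is a monoid, and $b\le a\backslash c\iff a\cdot b\le c\iff a\le c/b$ for all $a,b,c\in A$. $\mathbb{ISP}(\mathcal{C})$ is the class of isomorphic copies of subalgebras of direct products of members of $\mathcal{C}$. A variety of residuated lattices is Hamiltonian if it satisfies $(\mathrm{e}\wedge x)^ky\approx y(\mathrm{e}\wedge x)^k$ for some $k\ge1$. Canonical extensions. A completion of a poset $P$ is a complete lattice $C$ with an order embedding of $P$ into $C$ preserving all existing finite meets and joins; $P$ is identified with its image. An element of $C$ is open (resp. closed) if it is a join (resp. meet) in $C$ of a nonempty subset of $P$; $O$ and $K$ denote the sets of open and closed elements. The completion is dense if every element of $C$ is both a join of closed elements and a meet of open elements; it is compact if for all nonempty $A\subseteq K$, $B\subseteq O$: $\bigwedge A\le\bigvee B$ iff $\bigwedge A_0\le\bigvee B_0$ for some finite nonempty $A_0\subseteq A$, $B_0\subseteq B$. A dense compact completion is called the canonical extension $P^\sigma$ of $P$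 (unique up to isomorphism fixing $P$). For $f\colon P^n\to P$, the maps $f^\sigma,f^\pi\colon(P^\sigma)^n\to P^\sigma$ are $$f^\sigma(x)=\bigvee\bigl\{\bigwedge\{f(a)\mid a\in P^n,\ p\le a\le q\}\mid p\in K^n,\ q\in O^n,\ p\le x\le q\bigr\},$$ $$f^\pi(x)=\bigwedge\bigl\{\bigvee\{f(a)\mid a\in P^n,\ p\le a\le q\}\mid p\in K^n,\ q\in O^n,\ p\le x\le q\bigr\}.$$ The canonical extension of a residuated lattice $\mathbf{A}$ is $\mathbf{A}^\sigma=\langle A^\sigma,\wedge^\sigma,\vee^\sigma,\cdot^\sigma,\backslash^\pi,/^\pi,\mathrm{e}\rangle$, which is again a residuated lattice. $\mathcal{C}$ is closed under canonical extensions if $\mathbf{A}\in\mathcal{C}$ implies $\mathbf{A}^\sigma\in\mathcal{C}$. $\mathcal{V}$ is coherent if every finitely generated subalgebra of a finitely presented member of $\mathcal{V}$ is finitely presented (finitely presented: isomorphic to a quotient of a finitely generated free algebra of $\mathcal{V}$ by a finitely generated congruence). A variety has EDPC if there are finitely many pairs of $4$-variable terms $(p_i,q_i)$ such that for every member $\mathbf{A}$ and $a,b,c,d\in A$, $\langle c,d\rangle$ is in the congruence generated by $\langle a,b\rangle$ iff $p_i(a,b,c,d)=q_i(a,b,c,d)$ for all $i$. -}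

module Defs where

open import Level using (Level; _⊔_; Lift) renaming (suc to lsuc)
open import Algebra.Core using (Op₂)
open import Algebra.Definitions using (Congruent₂)
open import Algebra.Structures using (IsMonoid)
open import Algebra.Lattice.Bundles using (Lattice)
open import Algebra.Lattice.Structures using (IsLattice)
import Algebra.Lattice.Properties.Lattice as LatticeProperties
open import Data.Fin.Base using (Fin)
open import Data.Fin.Patterns using (0F; 1F; 2F; 3F)
open import Data.List.Base using (List; []; _∷_)
open import Data.List.Membership.Propositional using () renaming (_∈_ to _∈ₗ_)
import Data.List.Membership.Setoid as SetoidMembership
open import Data.List.NonEmpty.Base using (List⁺; toList)
open import Data.List.Relation.Unary.All using (All)
open import Data.Nat.Base using (ℕ; zero; suc) renaming (_≤_ to _≤ₙ_)
open import Data.Product.Base using (Σ; ∃-syntax; _×_; _,_; proj₁; proj₂)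
open import Function.Bundles using (_⇔_)
open import Function.Definitions using (Bijective)
open import Relation.Binary.Bundles using (Poset)
open import Relation.Binary.Core using (Rel)
open import Relation.Binary.Morphism.Structures using (IsOrderMonomorphism)
open import Relation.Binary.Structures using (IsEquivalence)
open import Relation.Unary using (Pred; _∈_; _⊆_; _≐_; Satisfiable)

private
  variable
    ℓ v w : Level

------------------------------------------------------------------------
-- Algebras and terms in the signature ∧, ∨, ·, \, /, e

data Op : Set where
  meet join mult under over : Op

-- Algebras are setoid-based: _≈_ is the equality of the algebra, so
-- quotients change _≈_ and keep the carrier.

record Algebra (ℓ : Level) : Set (lsuc ℓ) where
  infix  4 _≈_ _≤_
  infixr 7 _∧_
  infixr 6 _∨_
  infixl 8 _·_
  field
    Carrier       : Set ℓ
    _≈_           : Rel Carrier ℓ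
    isEquivalence : IsEquivalence _≈_
    op            : Op → Op₂ Carrier
    e             : Carrier
    op-cong       : ∀ o → Congruent₂ _≈_ (op o)

  _∧_ _∨_ _·_ _⑊_ _⫽_ : Op₂ Carrier
  _∧_ = op meet
  _∨_ = op join
  _·_ = op mult
  _⑊_ = op under
  _⫽_ = op over

  _≤_ : Rel Carrier ℓ
  a ≤ b = a ≈ a ∧ b

Class : (ℓ v : Level) → Set (lsuc ℓ ⊔ lsuc v)
Class ℓ v = Pred (Algebra ℓ) v

record IsResiduatedLattice (A : Algebra ℓ) : Set ℓ where
  open Algebra A
  field
    isLattice : IsLattice _≈_ _∨_ _∧_
    isMonoid  : IsMonoid _≈_ _·_ e
    residualˡ : ∀ a b c → b ≤ a ⑊ c ⇔ a · b ≤ c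
    residualʳ : ∀ a b c → a · b ≤ c ⇔ a ≤ c ⫽ b

  lattice : Lattice ℓ ℓ
  lattice = record { isLattice = isLattice }

  -- Its order is definitionally Algebra._≤_.
  poset : Poset ℓ ℓ ℓ
  poset = LatticeProperties.poset lattice

data Term (X : Set) : Set where
  var : X → Term X
  ε   : Term X
  app : Op → Term X → Term X → Term X

infixr 7 _∧̇_
_∧̇_ _·̇_ : {X : Set} → Term X → Term X → Term X
s ∧̇ t = app meet s t
s ·̇ t = app mult s t

infixr 9 _^̇_
_^̇_ : {X : Set} → Term X → ℕ → Term X
t ^̇ zero  = ε
t ^̇ suc n = t ·̇ (t ^̇ n)

module _ (A : Algebra ℓ) where
  open Algebra A

  eval : {X : Set} → (X → Carrier) → Term X → Carrier
  eval ρ (var x)     = ρ x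
  eval ρ ε           = e
  eval ρ (app o s t) = op o (eval ρ s) (eval ρ t)

Equation : Set → Set
Equation X = Term X × Term X

infix 5 _≈̇_
_≈̇_ : {X : Set} → Term X → Term X → Equation X
_≈̇_ = _,_

Satisfies : {X : Set} (A : Algebra ℓ) → (X → Algebra.Carrier A) → Equation X → Set ℓ
Satisfies A ρ (s , t) = Algebra._≈_ A (eval A ρ s) (eval A ρ t)

infix 4 _⊨_
_⊨_ : Class ℓ v → Equation ℕ → Set (lsuc ℓ ⊔ v)
𝒱 ⊨ E = ∀ A → A ∈ 𝒱 → ∀ ρ → Satisfies A ρ E

------------------------------------------------------------------------
-- Homomorphisms, subalgebras, products, quotients

record IsHomomorphism (A B : Algebra ℓ)
                      (h : Algebra.Carrier A → Algebra.Carrier B) : Set ℓ where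
  private
    module A = Algebra A
    module B = Algebra B
  field
    cong   : ∀ {x y} → x A.≈ y → h x B.≈ h y
    e-homo : h A.e B.≈ B.e
    homo   : ∀ o x y → h (A.op o x y) B.≈ B.op o (h x) (h y)

infix 4 _≅_
_≅_ : Rel (Algebra ℓ) ℓ
A ≅ B = ∃[ h ] IsHomomorphism A B h × Bijective (Algebra._≈_ A) (Algebra._≈_ B) h

record IsSubuniverse (A : Algebra ℓ) (S : Pred (Algebra.Carrier A) ℓ) : Set ℓ where
  open Algebra A
  field
    resp      : ∀ {x y} → x ≈ y → x ∈ S → y ∈ S
    e-closed  : e ∈ S
    op-closed : ∀ o {x y} → x ∈ S → y ∈ S → op o x y ∈ S

subalgebra : (A : Algebra ℓ) (S : Pred (Algebra.Carrier A) ℓ) → IsSubuniverse A S → Algebra ℓ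
subalgebra A S sub = record
  { Carrier       = Σ Carrier S
  ; _≈_           = λ x y → proj₁ x ≈ proj₁ y
  ; isEquivalence = record { refl = refl ; sym = sym ; trans = trans }
  ; op            = λ o (x , x∈S) (y , y∈S) → op o x y , op-closed o x∈S y∈S
  ; e             = e , e-closed
  ; op-cong       = λ o → op-cong o
  }
  where
  open Algebra A
  open IsEquivalence isEquivalence
  open IsSubuniverse sub

module _ (A : Algebra ℓ) (xs : List (Algebra.Carrier A)) where
  open Algebra A

  data Sg : Pred Carrier ℓ where
    Sg-gen  : ∀ {x} → x ∈ₗ xs → Sg x
    Sg-resp : ∀ {x y} → x ≈ y → Sg x → Sg y
    Sg-e    : Sg e
    Sg-op   : ∀ o {x y} → Sg x → Sg y → Sg (op o x y)

  Sg-isSubuniverse : IsSubuniverse A Sg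
  Sg-isSubuniverse = record { resp = Sg-resp ; e-closed = Sg-e ; op-closed = Sg-op }

  generatedSubalgebra : Algebra ℓ
  generatedSubalgebra = subalgebra A Sg Sg-isSubuniverse

product : (I : Set ℓ) → (I → Algebra ℓ) → Algebra ℓ
product I A = record
  { Carrier       = ∀ i → A.Carrier i
  ; _≈_           = λ x y → ∀ i → A._≈_ i (x i) (y i)
  ; isEquivalence = record
    { refl  = λ i → IsEquivalence.refl (A.isEquivalence i)
    ; sym   = λ p i → IsEquivalence.sym (A.isEquivalence i) (p i)
    ; trans = λ p q i → IsEquivalence.trans (A.isEquivalence i) (p i) (q i)
    }
  ; op            = λ o x y i → A.op i o (x i) (y i)
  ; e             = λ i → A.e i
  ; op-cong       = λ o p q i → A.op-cong i o (p i) (q i)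
  }
  where module A i = Algebra (A i)

ISP : Class ℓ v → Class ℓ (lsuc ℓ ⊔ v)
ISP {ℓ = ℓ} 𝒞 A =
  ∃[ I ] Σ (I → Algebra ℓ) λ B → (∀ i → B i ∈ 𝒞) ×
  ∃[ S ] Σ (IsSubuniverse (product I B) S) λ sub → A ≅ subalgebra (product I B) S sub

module _ (A : Algebra ℓ) (R : List (Algebra.Carrier A × Algebra.Carrier A)) where
  open Algebra A

  -- The congruence generated by R.
  data Cg : Rel Carrier ℓ where
    Cg-gen   : ∀ {x y} → (x , y) ∈ₗ R → Cg x y
    Cg-refl  : ∀ {x y} → x ≈ y → Cg x y
    Cg-sym   : ∀ {x y} → Cg x y → Cg y x
    Cg-trans : ∀ {x y z} → Cg x y → Cg y z → Cg x z
    Cg-op    : ∀ o {x x′ y y′} → Cg x x′ → Cg y y′ → Cg (op o x y) (op o x′ y′)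

  quotient : Algebra ℓ
  quotient = record
    { Carrier       = Carrier
    ; _≈_           = Cg
    ; isEquivalence = record
      { refl  = Cg-refl (IsEquivalence.refl isEquivalence)
      ; sym   = Cg-sym
      ; trans = Cg-trans
      }
    ; op            = op
    ; e             = e
    ; op-cong       = Cg-op
    }

------------------------------------------------------------------------
-- Varieties

IsVariety : Class ℓ v → Set (lsuc ℓ ⊔ v)
IsVariety {ℓ = ℓ} 𝒱 = Σ (Pred (Equation ℕ) ℓ) λ E →
  𝒱 ≐ λ A → ∀ eq → eq ∈ E → ∀ ρ → Satisfies A ρ eq

record IsFree (𝒱 : Class ℓ v) (n : ℕ) (F : Algebra ℓ)
              (x : Fin n → Algebra.Carrier F) : Set (lsuc ℓ ⊔ v) where
  field
    member : F ∈ 𝒱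
    extend : ∀ A → A ∈ 𝒱 → (g : Fin n → Algebra.Carrier A) →
             ∃[ h ] IsHomomorphism F A h × (∀ i → Algebra._≈_ A (h (x i)) (g i))
    unique : ∀ A → A ∈ 𝒱 → ∀ {h k} → IsHomomorphism F A h → IsHomomorphism F A k →
             (∀ i → Algebra._≈_ A (h (x i)) (k (x i))) →
             ∀ a → Algebra._≈_ A (h a) (k a)

FinitelyPresented : Class ℓ v → Algebra ℓ → Set (lsuc ℓ ⊔ v)
FinitelyPresented 𝒱 A =
  ∃[ n ] ∃[ F ] ∃[ x ] IsFree 𝒱 n F x × ∃[ R ] A ≅ quotient F R

IsCoherent : Class ℓ v → Set (lsuc ℓ ⊔ v)
IsCoherent 𝒱 = ∀ A → A ∈ 𝒱 → FinitelyPresented 𝒱 A →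
  ∀ xs → FinitelyPresented 𝒱 (generatedSubalgebra A xs)

x̂ ŷ : Term ℕ
x̂ = var 0
ŷ = var 1

IsHamiltonian : Class ℓ v → Set (lsuc ℓ ⊔ v)
IsHamiltonian 𝒱 =
  ∃[ k ] 1 ≤ₙ k × 𝒱 ⊨ ((ε ∧̇ x̂) ^̇ k) ·̇ ŷ ≈̇ ŷ ·̇ ((ε ∧̇ x̂) ^̇ k)

assign₄ : {X : Set ℓ} → X → X → X → X → Fin 4 → X
assign₄ a b c d 0F = a
assign₄ a b c d 1F = b
assign₄ a b c d 2F = c
assign₄ a b c d 3F = d

HasEDPC : Class ℓ v → Set (lsuc ℓ ⊔ v)
HasEDPC 𝒱 = Σ (List (Equation (Fin 4))) λ E → ∀ A → A ∈ 𝒱 → ∀ a b c d →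
  Cg A ((a , b) ∷ []) c d ⇔ All (Satisfies A (assign₄ a b c d)) E

------------------------------------------------------------------------
-- Canonical extensions of posets

module _ (P : Poset ℓ ℓ ℓ) where
  open Poset P

  IsSup IsInf : Pred Carrier w → Carrier → Set (ℓ ⊔ w)
  IsSup S x = (∀ y → y ∈ S → y ≤ x) × (∀ z → (∀ y → y ∈ S → y ≤ z) → x ≤ z)
  IsInf S x = (∀ y → y ∈ S → x ≤ y) × (∀ z → (∀ y → y ∈ S → z ≤ y) → z ≤ x)

  finite : List Carrier → Pred Carrier ℓ
  finite xs y = SetoidMembership._∈_ Eq.setoid y xs

-- "Open" and "closed" quantify over subsets of P, so they are predicates
-- one universe up; complete lattices therefore have joins and meets of
-- predicates of that level.  Under excluded middle the level of a
-- predicate is immaterial, and this is ordinary completeness.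

record CompleteLattice (ℓ : Level) : Set (lsuc (lsuc ℓ)) where
  field
    poset : Poset ℓ ℓ ℓ
  open Poset poset public
  field
    ⋁ ⋀   : Pred Carrier (lsuc ℓ) → Carrier
    ⋁-sup : ∀ S → IsSup poset S (⋁ S)
    ⋀-inf : ∀ S → IsInf poset S (⋀ S)

  ⋁′ ⋀′ : Pred Carrier ℓ → Carrier
  ⋁′ S = ⋁ λ x → Lift (lsuc ℓ) (S x)
  ⋀′ S = ⋀ λ x → Lift (lsuc ℓ) (S x)

record Completion (P : Poset ℓ ℓ ℓ) : Set (lsuc (lsuc ℓ)) where
  private module P = Poset P
  field
    completeLattice : CompleteLattice ℓ
  open CompleteLattice completeLattice public
  field
    ι           : P.Carrier → Carrier
    ι-embedding : IsOrderMonomorphism P._≈_ _≈_ P._≤_ _≤_ ι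

  image : Pred P.Carrier ℓ → Pred Carrier ℓ
  image S y = ∃[ a ] a ∈ S × y ≈ ι a

  field
    ι-sup : ∀ as a → IsSup P (finite P as) a → IsSup poset (image (finite P as)) (ι a)
    ι-inf : ∀ as a → IsInf P (finite P as) a → IsInf poset (image (finite P as)) (ι a)

  IsOpen IsClosed : Pred Carrier (lsuc ℓ)
  IsOpen   x = ∃[ S ] Satisfiable S × IsSup poset (image S) x
  IsClosed x = ∃[ S ] Satisfiable S × IsInf poset (image S) x

  IsDense : Set (lsuc (lsuc ℓ))
  IsDense = ∀ x →
    (Σ (Pred Carrier (lsuc ℓ)) λ S → S ⊆ IsClosed × IsSup poset S x) ×
    (Σ (Pred Carrier (lsuc ℓ)) λ S → S ⊆ IsOpen × IsInf poset S x)

  IsCompact : Set (lsuc (lsuc ℓ))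
  IsCompact = ∀ (A B : Pred Carrier (lsuc ℓ)) →
    A ⊆ IsClosed → B ⊆ IsOpen → Satisfiable A → Satisfiable B →
    ⋀ A ≤ ⋁ B ⇔
      (Σ (List⁺ Carrier × List⁺ Carrier) λ (A₀ , B₀) →
         All A (toList A₀) × All B (toList B₀) ×
         ⋀′ (finite poset (toList A₀)) ≤ ⋁′ (finite poset (toList B₀)))

record CanonicalExtension (P : Poset ℓ ℓ ℓ) : Set (lsuc (lsuc ℓ)) where
  field
    completion : Completion P
  open Completion completion public
  field
    dense   : IsDense
    compact : IsCompact

  private module P = Poset P

  -- { f(a) ∣ a ∈ P², p ≤ a ≤ q }
  values : Op₂ P.Carrier → (p₁ p₂ q₁ q₂ : Carrier) → Pred Carrier ℓ
  values f p₁ p₂ q₁ q₂ z = ∃[ a₁ ] ∃[ a₂ ]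
    (p₁ ≤ ι a₁ × ι a₁ ≤ q₁) × (p₂ ≤ ι a₂ × ι a₂ ≤ q₂) × z ≈ ι (f a₁ a₂)

  -- { val(p , q) ∣ p ∈ K², q ∈ O², p ≤ x ≤ q }
  record Approximants (val : (p₁ p₂ q₁ q₂ : Carrier) → Carrier)
                      (x₁ x₂ z : Carrier) : Set (lsuc ℓ) where
    field
      p₁ p₂ q₁ q₂ : Carrier
      closed₁     : IsClosed p₁
      closed₂     : IsClosed p₂
      open₁       : IsOpen q₁
      open₂       : IsOpen q₂
      between₁    : p₁ ≤ x₁ × x₁ ≤ q₁
      between₂    : p₂ ≤ x₂ × x₂ ≤ q₂
      value       : z ≈ val p₁ p₂ q₁ q₂

  infix 9 _^σ _^π
  _^σ _^π : Op₂ P.Carrier → Op₂ Carrier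
  (f ^σ) x₁ x₂ = ⋁ (Approximants (λ p₁ p₂ q₁ q₂ → ⋀′ (values f p₁ p₂ q₁ q₂)) x₁ x₂)
  (f ^π) x₁ x₂ = ⋀ (Approximants (λ p₁ p₂ q₁ q₂ → ⋁′ (values f p₁ p₂ q₁ q₂)) x₁ x₂)

  Approximants-resp : ∀ {val x₁ x₂ y₁ y₂} → x₁ ≈ y₁ → x₂ ≈ y₂ →
                      Approximants val x₁ x₂ ⊆ Approximants val y₁ y₂
  Approximants-resp eq₁ eq₂ I = record
    { Approximants I
    ; between₁ = shift eq₁ (Approximants.between₁ I)
    ; between₂ = shift eq₂ (Approximants.between₂ I)
    }
    where
    shift : ∀ {p q x y} → x ≈ y → p ≤ x × x ≤ q → p ≤ y × y ≤ q
    shift eq (p≤x , x≤q) = trans p≤x (reflexive eq) , trans (reflexive (Eq.sym eq)) x≤q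

  ⋁-mono : ∀ {S T} → S ⊆ T → ⋁ S ≤ ⋁ T
  ⋁-mono {S} {T} S⊆T = proj₂ (⋁-sup S) _ λ y y∈S → proj₁ (⋁-sup T) y (S⊆T y∈S)

  ⋀-mono : ∀ {S T} → S ⊆ T → ⋀ T ≤ ⋀ S
  ⋀-mono {S} {T} S⊆T = proj₂ (⋀-inf S) _ λ y y∈S → proj₁ (⋀-inf T) y (S⊆T y∈S)

  ^σ-cong : ∀ f → Congruent₂ _≈_ (f ^σ)
  ^σ-cong f eq₁ eq₂ = antisym
    (⋁-mono (Approximants-resp eq₁ eq₂))
    (⋁-mono (Approximants-resp (Eq.sym eq₁) (Eq.sym eq₂)))

  ^π-cong : ∀ f → Congruent₂ _≈_ (f ^π)
  ^π-cong f eq₁ eq₂ = antisym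
    (⋀-mono (Approximants-resp (Eq.sym eq₁) (Eq.sym eq₂)))
    (⋀-mono (Approximants-resp eq₁ eq₂))

------------------------------------------------------------------------
-- Canonical extensions of residuated lattices

module _ (A : Algebra ℓ) (rl : IsResiduatedLattice A)
         (X : CanonicalExtension (IsResiduatedLattice.poset rl)) where
  private
    module A = Algebra A
    module X = CanonicalExtension X
  open X using (_^σ; _^π; ^σ-cong; ^π-cong)

  canonicalAlgebra : Algebra ℓ
  canonicalAlgebra = record
    { Carrier       = X.Carrier
    ; _≈_           = X._≈_
    ; isEquivalence = X.isEquivalence
    ; op            = operation
    ; e             = X.ι A.e
    ; op-cong       = operation-cong
    }
    where
    operation : Op → Op₂ X.Carrier
    operation meet  = A._∧_ ^σ
    operation join  = A._∨_ ^σ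
    operation mult  = A._·_ ^σ
    operation under = A._⑊_ ^π
    operation over  = A._⫽_ ^π

    operation-cong : ∀ o → Congruent₂ X._≈_ (operation o)
    operation-cong meet  = ^σ-cong A._∧_
    operation-cong join  = ^σ-cong A._∨_
    operation-cong mult  = ^σ-cong A._·_
    operation-cong under = ^π-cong A._⑊_
    operation-cong over  = ^π-cong A._⫽_

-- A^σ is only determined up to isomorphism fixing A, and classes need not
-- be closed under isomorphism, so some copy of A^σ is required to lie in 𝒞.

ClosedUnderCanonicalExtensions : Class ℓ v → Set (lsuc (lsuc ℓ) ⊔ v)
ClosedUnderCanonicalExtensions 𝒞 = ∀ A (rl : IsResiduatedLattice A) → A ∈ 𝒞 →
  Σ (CanonicalExtension (IsResiduatedLattice.poset rl)) λ X →
    canonicalAlgebra A rl X ∈ 𝒞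

{-# OPTIONS --safe #-}
-- Write c = e ∧ u, and let A be presented by u, y, x with y ≤ x ≤ e and x = c · x.
-- Then y ≤ x ≤ cᵏ for all k.  Conversely, whenever y ≤ cᵏ for all k in a member B of 𝒞,
-- the element x = ⋀ cᵏ of the canonical extension of B satisfies the relations of A,
-- because compactness gives c · ⋀ cᵏ = ⋀ cᵏ⁺¹.  So the subalgebra of A generated by u
-- and y is presented by all the relations y ≤ cᵏ together.  By coherence finitely many
-- of them suffice: for some n, y ≤ cⁿ implies y ≤ cⁿ⁺¹, and y = cⁿ gives cⁿ ≤ cⁿ⁺¹.
--
-- In the Hamiltonian case a power d of e ∧ (a \ b) ∧ (b \ a) is then a central
-- idempotent, and d · x ≈ d · y defines the congruence generated by (a , b).
module Submission where

open import Defs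
open import Level using (Level; Lift; lift; lower; 0ℓ) renaming (suc to lsuc)
open import Algebra.Structures using (module IsMonoid)
import Algebra.Lattice.Properties.Lattice as LatticeProperties
open import Data.Fin.Base using (Fin)
open import Data.Fin.Patterns using (0F; 1F; 2F; 3F)
open import Data.List.Base using (List; []; _∷_; lookup; allFin)
open import Data.List.Membership.Propositional using () renaming (_∈_ to _∈ₗ_)
open import Data.List.Membership.Propositional.Properties using (∈-allFin; ∈-lookup)
open import Data.List.Relation.Unary.All as All using (All; []; _∷_)
open import Data.List.Relation.Unary.Any as Any using (here; there)
open import Data.List.Relation.Unary.Any.Properties using (lookup-index)
open import Data.Nat.Base using (ℕ; zero; suc; _+_; _*_; _∸_; z≤n; s≤s)
  renaming (_≤_ to _≤ₙ_; _⊔_ to _⊔ₙ_)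
open import Data.Nat.Properties
  using (m≤m⊔n; m≤n⊔m; m∸n+n≡m; m≤m*n; ≤-refl; ≤-trans; n≤1+n; m≤n+m)
open import Data.Product.Base using (_×_; ∃-syntax; _,_; proj₁; proj₂; swap)
open import Data.Unit.Polymorphic.Base using (⊤; tt)
open import Function.Base using (_∘_; id; const)
open import Function.Bundles using (_⇔_; mk⇔; module Equivalence)
open import Relation.Binary.Bundles using (Setoid)
open import Relation.Binary.Core using (Rel)
open import Relation.Binary.Lattice using () renaming (module Lattice to OrderedLattice)
open import Relation.Binary.Morphism.Structures using (module IsOrderMonomorphism)
open import Relation.Binary.PropositionalEquality
  using (_≡_; subst; cong; cong₂)
  renaming (refl to ≡-refl; sym to ≡-sym)
open import Relation.Binary.Structures using (IsEquivalence)
import Relation.Binary.Reasoning.Setoid as SetoidReasoning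
import Relation.Binary.Reasoning.PartialOrder as PosetReasoning
open import Relation.Unary using (Pred; _∈_; _⊆_; _≐_; ⋃; ∅)

private
  variable
    ℓ ℓ′ v w a : Level
    X Y : Set

-- Residuated lattices

module Powers (A : Algebra ℓ) where
  open Algebra A

  infixr 9 _^_
  _^_ : Carrier → ℕ → Carrier
  x ^ zero  = e
  x ^ suc n = x · x ^ n

  eval-^ : (ρ : X → Carrier) (t : Term X) (n : ℕ) → eval A ρ (t ^̇ n) ≡ eval A ρ t ^ n
  eval-^ ρ t zero    = ≡-refl
  eval-^ ρ t (suc n) = cong (eval A ρ t ·_) (eval-^ ρ t n)

module ResiduatedLattice {A : Algebra ℓ} (rl : IsResiduatedLattice A) where
  open Algebra A hiding (isEquivalence)
  open IsResiduatedLattice rl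
  open IsMonoid isMonoid using (assoc; identityˡ; identityʳ; ∙-cong; ∙-congˡ; ∙-congʳ)
  open OrderedLattice (LatticeProperties.∨-∧-orderTheoreticLattice lattice)
    using (antisym; x∧y≤x; x∧y≤y; ∧-greatest; x≤x∨y; y≤x∨y; ∨-least; isEquivalence)
    renaming (refl to ≤-rfl; trans to ≤-trn; reflexive to ≤-reflexive) public
  open IsEquivalence isEquivalence using (refl; sym; trans) public
  open Powers A
  open PosetReasoning poset

  private
    module Resˡ {a b c} = Equivalence (residualˡ a b c)
    module Resʳ {a b c} = Equivalence (residualʳ a b c)

  ·-monoʳ : ∀ a {b c} → b ≤ c → a · b ≤ a · c
  ·-monoʳ a b≤c = Resˡ.to (≤-trn b≤c (Resˡ.from ≤-rfl))

  ·-monoˡ : ∀ c {a b} → a ≤ b → a · c ≤ b · c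
  ·-monoˡ c a≤b = Resʳ.from (≤-trn a≤b (Resʳ.to ≤-rfl))

  ·-mono : ∀ {a b c d} → a ≤ b → c ≤ d → a · c ≤ b · d
  ·-mono {b = b} {c} a≤b c≤d = ≤-trn (·-monoˡ c a≤b) (·-monoʳ b c≤d)

  ∧-monoʳ : ∀ a {b c} → b ≤ c → a ∧ b ≤ a ∧ c
  ∧-monoʳ a {b} b≤c = ∧-greatest (x∧y≤x a b) (≤-trn (x∧y≤y a b) b≤c)

  ^-homo-+ : ∀ x i j → x ^ (i + j) ≈ x ^ i · x ^ j
  ^-homo-+ x zero    j = sym (identityˡ _)
  ^-homo-+ x (suc i) j = trans (∙-congˡ (^-homo-+ x i j)) (sym (assoc _ _ _))

  module _ {x} (x≤e : x ≤ e) where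

    ·-decreasing : ∀ a → x · a ≤ a
    ·-decreasing a = ≤-trn (·-monoˡ a x≤e) (≤-reflexive (identityˡ a))

    ^-antitone : ∀ {i j} → i ≤ₙ j → x ^ j ≤ x ^ i
    ^-antitone {j = zero}  z≤n       = ≤-rfl
    ^-antitone {j = suc j} z≤n       = ≤-trn (·-decreasing _) (^-antitone {j = j} z≤n)
    ^-antitone             (s≤s i≤j) = ·-monoʳ x (^-antitone i≤j)

  module _ {x n} (stable : x ^ suc n ≈ x ^ n) where

    ^-stable : ∀ {m} → n ≤ₙ m → x ^ m ≈ x ^ n
    ^-stable {m} n≤m = subst (λ i → x ^ i ≈ x ^ n) (m∸n+n≡m n≤m) (go (m ∸ n))
      where
      go : ∀ j → x ^ (j + n) ≈ x ^ n
      go zero    = refl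
      go (suc j) = trans (∙-congˡ (go j)) stable

    ^-idempotent : ∀ {m} → n ≤ₙ m → x ^ m · x ^ m ≈ x ^ m
    ^-idempotent {m} n≤m = begin-equality
      x ^ m · x ^ m  ≈⟨ ^-homo-+ x m m ⟨
      x ^ (m + m)    ≈⟨ ^-stable (≤-trans n≤m (m≤n+m m m)) ⟩
      x ^ n          ≈⟨ ^-stable n≤m ⟨
      x ^ m          ∎

  Central : Pred Carrier _
  Central x = ∀ y → x · y ≈ y · x

  ^-central : ∀ {x k} → Central (x ^ k) → ∀ j → Central (x ^ (j * k))
  ^-central         central zero    y = trans (identityˡ y) (sym (identityʳ y))
  ^-central {x} {k} central (suc j) y = begin-equality
    x ^ (k + j * k) · y        ≈⟨ ∙-congʳ (^-homo-+ x k (j * k)) ⟩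
    x ^ k · x ^ (j * k) · y    ≈⟨ assoc _ _ _ ⟩
    x ^ k · (x ^ (j * k) · y)  ≈⟨ ∙-congˡ (^-central central j y) ⟩
    x ^ k · (y · x ^ (j * k))  ≈⟨ assoc _ _ _ ⟨
    x ^ k · y · x ^ (j * k)    ≈⟨ ∙-congʳ (central y) ⟩
    y · x ^ k · x ^ (j * k)    ≈⟨ assoc _ _ _ ⟩
    y · (x ^ k · x ^ (j * k))  ≈⟨ ∙-congˡ (^-homo-+ x k (j * k)) ⟨
    y · x ^ (k + j * k)        ∎

  -- For a central idempotent d ≤ e, the relation d · y ≈ d · z is a congruence.
  module CentralIdempotent {d} (d≤e : d ≤ e) (central : Central d)
                           (idempotent : d · d ≈ d) where

    infix 4 _⊑_ _~_
    -- The divisions reverse the order in one argument, so compatibility is proved for the one-sided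
    -- `⊑` first; `~-op` then combines the two halves.
    _⊑_ _~_ : Rel Carrier _
    y ⊑ z = d · y ≤ z
    y ~ z = y ⊑ z × z ⊑ y

    absorb : ∀ y → d · (d · y) ≈ d · y
    absorb y = trans (sym (assoc _ _ _)) (∙-congʳ idempotent)

    swap-central : ∀ y z → y · (d · z) ≈ d · (y · z)
    swap-central y z = begin-equality
      y · (d · z)  ≈⟨ assoc _ _ _ ⟨
      y · d · z    ≈⟨ ∙-congʳ (central y) ⟨
      d · y · z    ≈⟨ assoc _ _ _ ⟩
      d · (y · z)  ∎

    ⊑-trans : ∀ {x y z} → x ⊑ y → y ⊑ z → x ⊑ z
    ⊑-trans {x} {y} {z} x⊑y y⊑z = begin
      d · x        ≈⟨ absorb x ⟨
      d · (d · x)  ≤⟨ ·-monoʳ d x⊑y ⟩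
      d · y        ≤⟨ y⊑z ⟩
      z            ∎

    ≤⇒⊑ : ∀ {x y} → x ≤ y → x ⊑ y
    ≤⇒⊑ x≤y = ≤-trn (·-decreasing d≤e _) x≤y

    ⊑⇒·-mono : ∀ {x y} → x ⊑ y → d · x ≤ d · y
    ⊑⇒·-mono {x} x⊑y = ≤-trn (≤-reflexive (sym (absorb x))) (·-monoʳ d x⊑y)

    ~⇒≈ : ∀ {x y} → x ~ y → d · x ≈ d · y
    ~⇒≈ (x⊑y , y⊑x) = antisym (⊑⇒·-mono x⊑y) (⊑⇒·-mono y⊑x)

    ∧-⊑ : ∀ {x x′ y y′} → x ⊑ x′ → y ⊑ y′ → x ∧ y ⊑ x′ ∧ y′
    ∧-⊑ {x} {y = y} p q = ∧-greatest (≤-trn (·-monoʳ d (x∧y≤x x y)) p)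
                                     (≤-trn (·-monoʳ d (x∧y≤y x y)) q)

    -- Multiplication by `d` on the left has the right adjoint `d ⑊_`; moved across it, the claim
    -- splits into one bound for each joinand.
    ∨-⊑ : ∀ {x x′ y y′} → x ⊑ x′ → y ⊑ y′ → x ∨ y ⊑ x′ ∨ y′
    ∨-⊑ p q = Resˡ.to (∨-least (Resˡ.from (≤-trn p (x≤x∨y _ _)))
                               (Resˡ.from (≤-trn q (y≤x∨y _ _))))

    -- Idempotence supplies a second copy of `d`, and centrality moves it past `x` to `y`.
    ·-⊑ : ∀ {x x′ y y′} → x ⊑ x′ → y ⊑ y′ → x · y ⊑ x′ · y′
    ·-⊑ {x} {x′} {y} {y′} p q = begin
      d · (x · y)        ≈⟨ absorb _ ⟨
      d · (d · (x · y))  ≈⟨ ∙-congˡ (swap-central x y) ⟨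
      d · (x · (d · y))  ≈⟨ assoc _ _ _ ⟨
      d · x · (d · y)    ≤⟨ ·-mono p q ⟩
      x′ · y′            ∎

    -- By residuation it suffices to bound `x′ · (d · (x ⑊ y))`. Centrality pulls `d` to the front,
    -- and then `x′ · (x ⑊ y) ⊑ x · (x ⑊ y) ≤ y ⊑ y′`.
    under-⊑ : ∀ {x x′ y y′} → x′ ⊑ x → y ⊑ y′ → x ⑊ y ⊑ x′ ⑊ y′
    under-⊑ {x} {x′} {y} {y′} p q = Resˡ.from (begin
      x′ · (d · (x ⑊ y))  ≈⟨ swap-central x′ _ ⟩
      d · (x′ · (x ⑊ y))  ≤⟨ ⊑-trans (·-⊑ p (≤⇒⊑ ≤-rfl)) (⊑-trans (≤⇒⊑ (Resˡ.to ≤-rfl)) q) ⟩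
      y′                  ∎)

    over-⊑ : ∀ {x x′ y y′} → x ⊑ x′ → y′ ⊑ y → x ⫽ y ⊑ x′ ⫽ y′
    over-⊑ {x} {x′} {y} {y′} p q = Resʳ.to (begin
      d · (x ⫽ y) · y′    ≈⟨ assoc _ _ _ ⟩
      d · ((x ⫽ y) · y′)  ≤⟨ ⊑-trans (·-⊑ (≤⇒⊑ ≤-rfl) q) (⊑-trans (≤⇒⊑ (Resʳ.from ≤-rfl)) p) ⟩
      x′                  ∎)

    ~-op : ∀ o {x x′ y y′} → x ~ x′ → y ~ y′ → op o x y ~ op o x′ y′
    ~-op meet  (p , p′) (q , q′) = ∧-⊑ p q , ∧-⊑ p′ q′
    ~-op join  (p , p′) (q , q′) = ∨-⊑ p q , ∨-⊑ p′ q′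
    ~-op mult  (p , p′) (q , q′) = ·-⊑ p q , ·-⊑ p′ q′
    ~-op under (p , p′) (q , q′) = under-⊑ p′ q , under-⊑ p q′
    ~-op over  (p , p′) (q , q′) = over-⊑ p q′ , over-⊑ p′ q

    Cg⇒~ : ∀ {a b} → a ~ b → ∀ {x y} → Cg A ((a , b) ∷ []) x y → x ~ y
    Cg⇒~ a~b (Cg-gen (here ≡-refl)) = a~b
    Cg⇒~ a~b (Cg-refl x≈y)          = ≤⇒⊑ (≤-reflexive x≈y) , ≤⇒⊑ (≤-reflexive (sym x≈y))
    Cg⇒~ a~b (Cg-sym p)             = swap (Cg⇒~ a~b p)
    Cg⇒~ a~b (Cg-trans p q)         =
      let (x⊑y , y⊑x) = Cg⇒~ a~b p ; (y⊑z , z⊑y) = Cg⇒~ a~b q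
      in ⊑-trans x⊑y y⊑z , ⊑-trans z⊑y y⊑x
    Cg⇒~ a~b (Cg-op o p q)          = ~-op o (Cg⇒~ a~b p) (Cg⇒~ a~b q)

  -- The largest `z ≤ e` with `a · z ≤ b` and `b · z ≤ a`.
  biresidual : Carrier → Carrier → Carrier
  biresidual a b = e ∧ ((a ⑊ b) ∧ (b ⑊ a))

  biresidual≤⑊ : ∀ a b → biresidual a b ≤ a ⑊ b
  biresidual≤⑊ a b = ≤-trn (x∧y≤y _ _) (x∧y≤x _ _)

  biresidual≤⑊′ : ∀ a b → biresidual a b ≤ b ⑊ a
  biresidual≤⑊′ a b = ≤-trn (x∧y≤y _ _) (x∧y≤y _ _)

  -- Replacing `a` by `b` turns both residuals into `b ⑊ b`, which lies above `e`.
  biresidual-Cg : ∀ a b → Cg A ((a , b) ∷ []) (biresidual a b) e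
  biresidual-Cg a b = Cg-trans
    (Cg-op meet (Cg-refl refl)
      (Cg-op meet (Cg-op under a~b (Cg-refl refl)) (Cg-op under (Cg-refl refl) a~b)))
    (Cg-refl (antisym (x∧y≤x _ _) (∧-greatest ≤-rfl (∧-greatest e≤b⑊b e≤b⑊b))))
    where
    a~b : Cg A ((a , b) ∷ []) a b
    a~b = Cg-gen (here ≡-refl)
    e≤b⑊b : e ≤ b ⑊ b
    e≤b⑊b = Resˡ.from (≤-reflexive (identityʳ b))

  ^-Cg : ∀ {R x} → Cg A R x e → ∀ n → Cg A R (x ^ n) e
  ^-Cg p zero    = Cg-refl refl
  ^-Cg p (suc n) = Cg-trans (Cg-op mult p (^-Cg p n)) (Cg-refl (identityˡ e))

  -- From left to right, `~` is a congruence that identifies `a` and `b`. From right to left, the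
  -- power of the biresidual is congruent to `e`, so multiplying by it does not leave a congruence
  -- class.
  Cg⇔≈ : ∀ {n k} → (∀ x → (e ∧ x) ^ suc n ≈ (e ∧ x) ^ n) →
         (∀ x → Central ((e ∧ x) ^ suc k)) → ∀ a b c d →
         Cg A ((a , b) ∷ []) c d ⇔
         biresidual a b ^ (suc n * suc k) · c ≈ biresidual a b ^ (suc n * suc k) · d
  Cg⇔≈ {n} {k} stable central a b c d = mk⇔ (~⇒≈ ∘ Cg⇒~ (a⊑b , b⊑a)) from
    where
    -- A multiple of `suc k` makes the power central, an exponent of at least `n` makes it
    -- idempotent, and a positive exponent puts it below `δ`.
    m : ℕ
    m = suc n * suc k
    δ z : Carrier
    δ = biresidual a b
    z = δ ^ m
    δ≤e : δ ≤ e
    δ≤e = x∧y≤x _ _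
    z≤e : z ≤ e
    z≤e = ^-antitone δ≤e {j = m} z≤n
    z≤δ : z ≤ δ
    z≤δ = ≤-trn (^-antitone δ≤e {1} {m} (s≤s z≤n)) (≤-reflexive (identityʳ δ))
    z-central : Central z
    z-central = ^-central {δ} {suc k} (central _) (suc n)
    open CentralIdempotent z≤e z-central
      (^-idempotent (stable _) (≤-trans (n≤1+n n) (m≤m*n (suc n) (suc k))))
    -- `δ` bounds products with `z` on the right, so centrality first turns `z · a` into `a · z`.
    a⊑b : a ⊑ b
    a⊑b = ≤-trn (≤-reflexive (z-central a)) (Resˡ.to (≤-trn z≤δ (biresidual≤⑊ a b)))
    b⊑a : b ⊑ a
    b⊑a = ≤-trn (≤-reflexive (z-central b)) (Resˡ.to (≤-trn z≤δ (biresidual≤⑊′ a b)))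
    ≈-z· : ∀ y → Cg A ((a , b) ∷ []) (z · y) y
    ≈-z· y = Cg-trans (Cg-op mult (^-Cg (biresidual-Cg a b) m) (Cg-refl refl))
                      (Cg-refl (identityˡ y))
    from : z · c ≈ z · d → Cg A ((a , b) ∷ []) c d
    from zc≈zd = Cg-trans (Cg-sym (≈-z· c)) (Cg-trans (Cg-refl zc≈zd) (≈-z· d))

-- Equationally definable principal congruences

assign₂ : {C : Set a} → C → C → ℕ → C
assign₂ x y zero    = x
assign₂ x y (suc _) = y

module _ {𝒱 : Class ℓ v} (residuated : 𝒱 ⊆ IsResiduatedLattice) where

  -- Since `n` and `k` are the same for all members of `𝒱`, the criterion of `Cg⇔≈` is a single
  -- equation between terms.
  hamiltonian⇒EDPC : ∀ n → 𝒱 ⊨ (ε ∧̇ x̂) ^̇ (suc n) ≈̇ (ε ∧̇ x̂) ^̇ n →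
                     IsHamiltonian 𝒱 → HasEDPC 𝒱
  hamiltonian⇒EDPC n stable (suc k , _ , hamiltonian) = E , λ A A∈𝒱 a b c d →
    let open Algebra A
        open Powers A
        open ResiduatedLattice (residuated A∈𝒱)
        stableA : ∀ x → (e ∧ x) ^ suc n ≈ (e ∧ x) ^ n
        stableA x = subst (λ z → (e ∧ x) · z ≈ z) (eval-^ (const x) (ε ∧̇ x̂) n)
                          (stable A A∈𝒱 (const x))
        centralA : ∀ x → Central ((e ∧ x) ^ suc k)
        -- `assign₂` repeats `y` at all later variables, which do not occur in the identity.
        centralA x y = subst (λ z → (e ∧ x) · z · y ≈ y · ((e ∧ x) · z))
                             (eval-^ (assign₂ x y) (ε ∧̇ x̂) k)
                             (hamiltonian A A∈𝒱 (assign₂ x y))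
        eval-δ : eval A (assign₄ a b c d) (δ ^̇ m) ≡ biresidual a b ^ m
        eval-δ = eval-^ (assign₄ a b c d) δ m
        open Equivalence (Cg⇔≈ {n} {k} stableA centralA a b c d)
    in mk⇔ (λ p → subst (λ z → z · c ≈ z · d) (≡-sym eval-δ) (to p) ∷ [])
           (λ { (p ∷ []) → from (subst (λ z → z · c ≈ z · d) eval-δ p) })
    where
    m : ℕ
    m = suc n * suc k
    δ : Term (Fin 4)
    δ = ε ∧̇ (app under (var 0F) (var 1F) ∧̇ app under (var 1F) (var 0F))
    E : List (Equation (Fin 4))
    E = ((δ ^̇ m) ·̇ var 2F ≈̇ (δ ^̇ m) ·̇ var 3F) ∷ []

-- Terms, presentations, and finite presentability

infixl 10 _[_]
_[_] : Term X → (X → Term Y) → Term Y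
var x     [ σ ] = σ x
ε         [ σ ] = ε
app o s t [ σ ] = app o (s [ σ ]) (t [ σ ])

[]-var : (t : Term X) → t [ var ] ≡ t
[]-var (var x)     = ≡-refl
[]-var ε           = ≡-refl
[]-var (app o s t) = cong₂ (app o) ([]-var s) ([]-var t)

eval-[] : (A : Algebra ℓ) (ρ : Y → Algebra.Carrier A) (σ : X → Term Y) (t : Term X) →
          eval A ρ (t [ σ ]) ≡ eval A (eval A ρ ∘ σ) t
eval-[] A ρ σ (var x)     = ≡-refl
eval-[] A ρ σ ε           = ≡-refl
eval-[] A ρ σ (app o s t) = cong₂ (Algebra.op A o) (eval-[] A ρ σ s) (eval-[] A ρ σ t)

module ≈ (A : Algebra ℓ) where
  open Algebra A
  open IsEquivalence isEquivalence public
  setoid : Setoid ℓ ℓ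
  setoid = record { isEquivalence = isEquivalence }

eval-cong : (A : Algebra ℓ) {ρ ρ′ : X → Algebra.Carrier A} →
            (∀ x → Algebra._≈_ A (ρ x) (ρ′ x)) →
            ∀ t → Algebra._≈_ A (eval A ρ t) (eval A ρ′ t)
eval-cong A eq (var x)     = eq x
eval-cong A eq ε           = ≈.refl A
eval-cong A eq (app o s t) = Algebra.op-cong A o (eval-cong A eq s) (eval-cong A eq t)

module _ {A B : Algebra ℓ} where
  private
    module A = Algebra A
    module B = Algebra B

  module Homomorphism {h : A.Carrier → B.Carrier} (H : IsHomomorphism A B h) where
    open IsHomomorphism H renaming (cong to h-cong) public

    eval-homo : (ρ : X → A.Carrier) (t : Term X) → h (eval A ρ t) B.≈ eval B (h ∘ ρ) t
    eval-homo ρ (var x)     = ≈.refl B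
    eval-homo ρ ε           = e-homo
    eval-homo ρ (app o s t) =
      ≈.trans B (homo o _ _) (B.op-cong o (eval-homo ρ s) (eval-homo ρ t))

    module _ (ρ : X → A.Carrier) (s t : Term X) where

      preserves : Satisfies A ρ (s , t) → Satisfies B (h ∘ ρ) (s , t)
      preserves p =
        ≈.trans B (≈.sym B (eval-homo ρ s)) (≈.trans B (h-cong p) (eval-homo ρ t))

      reflects : (∀ {x y} → h x B.≈ h y → x A.≈ y) →
                 Satisfies B (h ∘ ρ) (s , t) → Satisfies A ρ (s , t)
      reflects injective p =
        injective (≈.trans B (eval-homo ρ s) (≈.trans B p (≈.sym B (eval-homo ρ t))))

    Cg⇒≈ : ∀ {R} → (∀ {x y} → (x , y) ∈ₗ R → h x B.≈ h y) →
           ∀ {x y} → Cg A R x y → h x B.≈ h y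
    Cg⇒≈ R⇒≈ (Cg-gen p)     = R⇒≈ p
    Cg⇒≈ R⇒≈ (Cg-refl p)    = h-cong p
    Cg⇒≈ R⇒≈ (Cg-sym p)     = ≈.sym B (Cg⇒≈ R⇒≈ p)
    Cg⇒≈ R⇒≈ (Cg-trans p q) = ≈.trans B (Cg⇒≈ R⇒≈ p) (Cg⇒≈ R⇒≈ q)
    Cg⇒≈ R⇒≈ (Cg-op o p q)  = ≈.trans B (homo o _ _)
      (≈.trans B (B.op-cong o (Cg⇒≈ R⇒≈ p) (Cg⇒≈ R⇒≈ q)) (≈.sym B (homo o _ _)))

    quotient-extend : ∀ {R} → (∀ {x y} → (x , y) ∈ₗ R → h x B.≈ h y) →
                      IsHomomorphism (quotient A R) B h
    quotient-extend R⇒≈ = record { cong = Cg⇒≈ R⇒≈ ; e-homo = e-homo ; homo = homo }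

id-homo : (A : Algebra ℓ) → IsHomomorphism A A id
id-homo A = record { cong = id ; e-homo = ≈.refl A ; homo = λ _ _ _ → ≈.refl A }

∘-homo : {A B C : Algebra ℓ} {g : Algebra.Carrier B → Algebra.Carrier C}
         {h : Algebra.Carrier A → Algebra.Carrier B} →
         IsHomomorphism B C g → IsHomomorphism A B h → IsHomomorphism A C (g ∘ h)
∘-homo {C = C} G H = record
  { cong   = G.h-cong ∘ H.h-cong
  ; e-homo = ≈.trans C (G.h-cong H.e-homo) G.e-homo
  ; homo   = λ o x y → ≈.trans C (G.h-cong (H.homo o x y)) (G.homo o _ _)
  }
  where
  module G = Homomorphism G
  module H = Homomorphism H

module _ (A : Algebra ℓ) where
  open Algebra A

  quotient-homo : ∀ R → IsHomomorphism A (quotient A R) id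
  quotient-homo R = record
    { cong   = Cg-refl
    ; e-homo = ≈.refl (quotient A R)
    ; homo   = λ _ _ _ → ≈.refl (quotient A R)
    }

  proj₁-homo : ∀ {S} (sub : IsSubuniverse A S) → IsHomomorphism (subalgebra A S sub) A proj₁
  proj₁-homo sub = record { cong = id ; e-homo = ≈.refl A ; homo = λ _ _ _ → ≈.refl A }

  Sg⇒term : ∀ xs {a} → Sg A xs a → ∃[ t ] a ≈ eval A (lookup xs) t
  Sg⇒term xs (Sg-gen x∈xs)   = var (Any.index x∈xs) , ≈.reflexive A (lookup-index x∈xs)
  Sg⇒term xs (Sg-resp x≈y p) =
    let (t , eq) = Sg⇒term xs p in t , ≈.trans A (≈.sym A x≈y) eq
  Sg⇒term xs Sg-e            = ε , ≈.refl A
  Sg⇒term xs (Sg-op o p q)   =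
    let (s , eq₁) = Sg⇒term xs p ; (t , eq₂) = Sg⇒term xs q
    in app o s t , op-cong o eq₁ eq₂

evaluation-homo : {I : Set ℓ} (B : I → Algebra ℓ) (i : I) →
                  IsHomomorphism (product I B) (B i) (λ x → x i)
evaluation-homo B i = record
  { cong = λ p → p i ; e-homo = ≈.refl (B i) ; homo = λ _ _ _ → ≈.refl (B i) }

-- C is the subalgebra of the unary power of itself carried by everything.
⊆ISP : (𝒞 : Class ℓ v) → 𝒞 ⊆ ISP 𝒞
⊆ISP 𝒞 {C} C∈𝒞 = ⊤ , const C , const C∈𝒞 , const ⊤
  , record { resp = λ _ _ → tt ; e-closed = tt ; op-closed = λ _ _ _ → tt }
  , (λ x → const x , tt)
  , record { cong = const ; e-homo = const refl ; homo = λ _ _ _ → const refl }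
  , (λ p → p tt)
  , λ y → proj₁ y tt , λ p _ → p
  where open ≈ C

-- Monotonicity carries finitely many stages to their maximum.
All-stage : {A : Set a} {P : ℕ → Pred A ℓ′} → (∀ {i j} → i ≤ₙ j → P i ⊆ P j) →
            ∀ {xs} → All (λ x → ∃[ k ] x ∈ P k) xs → ∃[ k ] All (P k) xs
All-stage mono []               = 0 , []
All-stage mono ((i , p) ∷ rest) =
  let (j , ps) = All-stage mono rest
  in i ⊔ₙ j , mono (m≤m⊔n i j) p ∷ All.map (mono (m≤n⊔m i j)) ps

-- Equational logic with hypotheses

module Presentation (E : Pred (Equation ℕ) ℓ) where

  infix 4 _⊢_≋_
  -- Birkhoff's equational logic over the axioms `E`. Only axioms may be substituted into; in the
  -- hypotheses `Γ` the variables act as constants, so they serve as the relations of a presentation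
  -- with generators `X`.
  data _⊢_≋_ {X} (Γ : Pred (Equation X) 0ℓ) : Rel (Term X) ℓ where
    ≋-axiom : ∀ {s t} → (s , t) ∈ E → ∀ σ → Γ ⊢ s [ σ ] ≋ t [ σ ]
    ≋-hyp   : ∀ {s t} → (s , t) ∈ Γ → Γ ⊢ s ≋ t
    ≋-refl  : ∀ {s} → Γ ⊢ s ≋ s
    ≋-sym   : ∀ {s t} → Γ ⊢ s ≋ t → Γ ⊢ t ≋ s
    ≋-trans : ∀ {s t u} → Γ ⊢ s ≋ t → Γ ⊢ t ≋ u → Γ ⊢ s ≋ u
    ≋-app   : ∀ o {s s′ t t′} → Γ ⊢ s ≋ s′ → Γ ⊢ t ≋ t′ → Γ ⊢ app o s t ≋ app o s′ t′

  presented : Pred (Equation X) 0ℓ → Algebra ℓ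
  presented {X = X} Γ = record
    { Carrier       = Lift ℓ (Term X)
    ; _≈_           = λ s t → Γ ⊢ lower s ≋ lower t
    ; isEquivalence = record { refl = ≋-refl ; sym = ≋-sym ; trans = ≋-trans }
    ; op            = λ o s t → lift (app o (lower s) (lower t))
    ; e             = lift ε
    ; op-cong       = λ o → ≋-app o
    }

  ≋-weaken : {Γ Δ : Pred (Equation X) 0ℓ} → Γ ⊆ Δ → ∀ {s t} → Γ ⊢ s ≋ t → Δ ⊢ s ≋ t
  ≋-weaken Γ⊆Δ (≋-axiom p σ) = ≋-axiom p σ
  ≋-weaken Γ⊆Δ (≋-hyp p)     = ≋-hyp (Γ⊆Δ p)
  ≋-weaken Γ⊆Δ ≋-refl        = ≋-refl
  ≋-weaken Γ⊆Δ (≋-sym p)     = ≋-sym (≋-weaken Γ⊆Δ p)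
  ≋-weaken Γ⊆Δ (≋-trans p q) = ≋-trans (≋-weaken Γ⊆Δ p) (≋-weaken Γ⊆Δ q)
  ≋-weaken Γ⊆Δ (≋-app o p q) = ≋-app o (≋-weaken Γ⊆Δ p) (≋-weaken Γ⊆Δ q)

  module _ {Γ : ℕ → Pred (Equation X) 0ℓ} (mono : ∀ {i j} → i ≤ₙ j → Γ i ⊆ Γ j) where

    -- A derivation is finite, so it uses finitely many hypotheses, and these lie in a common stage.
    ≋-compact : ∀ {s t} → ⋃ ℕ Γ ⊢ s ≋ t → ∃[ k ] Γ k ⊢ s ≋ t
    ≋-compact (≋-axiom p σ)   = 0 , ≋-axiom p σ
    ≋-compact (≋-hyp (k , p)) = k , ≋-hyp p
    ≋-compact ≋-refl          = 0 , ≋-refl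
    ≋-compact (≋-sym p)       = let (k , p′) = ≋-compact p in k , ≋-sym p′
    ≋-compact (≋-trans p q)   =
      let (i , p′) = ≋-compact p ; (j , q′) = ≋-compact q
      in i ⊔ₙ j , ≋-trans (≋-weaken (mono (m≤m⊔n i j)) p′)
                          (≋-weaken (mono (m≤n⊔m i j)) q′)
    ≋-compact (≋-app o p q)   =
      let (i , p′) = ≋-compact p ; (j , q′) = ≋-compact q
      in i ⊔ₙ j , ≋-app o (≋-weaken (mono (m≤m⊔n i j)) p′)
                          (≋-weaken (mono (m≤n⊔m i j)) q′)

  eval-presented : (Γ : Pred (Equation X) 0ℓ) (ρ : Y → Lift ℓ (Term X)) (t : Term Y) →
                   eval (presented Γ) ρ t ≡ lift (t [ lower ∘ ρ ])
  eval-presented Γ ρ (var x)     = ≡-refl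
  eval-presented Γ ρ ε           = ≡-refl
  eval-presented Γ ρ (app o s t) =
    cong₂ (Algebra.op (presented Γ) o) (eval-presented Γ ρ s) (eval-presented Γ ρ t)

-- Presented and free algebras of a variety

module Variety (𝒱 : Class ℓ v) (variety : IsVariety 𝒱) where
  private
    E = proj₁ variety
  open Presentation E public

  presented-∈ : (Γ : Pred (Equation X) 0ℓ) → presented Γ ∈ 𝒱
  presented-∈ Γ = proj₂ (proj₂ variety) λ (s , t) st∈E ρ →
    cast (≡-sym (eval-presented Γ ρ s)) (≡-sym (eval-presented Γ ρ t))
         (≋-axiom st∈E (lower ∘ ρ))
    where
    open Algebra (presented Γ) using (_≈_)
    cast : ∀ {x x′ y y′} → x ≡ x′ → y ≡ y′ → x ≈ y → x′ ≈ y′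
    cast ≡-refl ≡-refl p = p

  quotient-∈ : ∀ {A} → A ∈ 𝒱 → ∀ R → quotient A R ∈ 𝒱
  quotient-∈ {A} A∈𝒱 R = proj₂ (proj₂ variety) λ (s , t) st∈E ρ →
    Homomorphism.preserves (quotient-homo A R) ρ s t
      (proj₁ (proj₂ variety) A∈𝒱 (s , t) st∈E ρ)

  sound : ∀ {B} → B ∈ 𝒱 → {Γ : Pred (Equation X) 0ℓ} (ρ : X → Algebra.Carrier B) →
          (∀ {s t} → (s , t) ∈ Γ → Satisfies B ρ (s , t)) →
          ∀ {s t} → Γ ⊢ s ≋ t → Satisfies B ρ (s , t)
  sound {B = B} B∈𝒱 ρ Γ-holds = go
    where
    open ≈ B
    go : ∀ {s t} → _ ⊢ s ≋ t → Satisfies B ρ (s , t)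
    go (≋-axiom {s} {t} st∈E σ) = trans (reflexive (eval-[] B ρ σ s))
      (trans (proj₁ (proj₂ variety) B∈𝒱 (s , t) st∈E (eval B ρ ∘ σ))
             (reflexive (≡-sym (eval-[] B ρ σ t))))
    go (≋-hyp st∈Γ)             = Γ-holds st∈Γ
    go ≋-refl                   = refl
    go (≋-sym p)                = sym (go p)
    go (≋-trans p q)            = trans (go p) (go q)
    go (≋-app o p q)            = Algebra.op-cong B o (go p) (go q)

  presented-extend : ∀ {B} → B ∈ 𝒱 → {Γ : Pred (Equation X) 0ℓ}
                     (ρ : X → Algebra.Carrier B) →
                     (∀ {s t} → (s , t) ∈ Γ → Satisfies B ρ (s , t)) →
                     IsHomomorphism (presented Γ) B (eval B ρ ∘ lower)
  presented-extend {B = B} B∈𝒱 ρ Γ-holds = record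
    { cong   = sound B∈𝒱 ρ Γ-holds
    ; e-homo = ≈.refl B
    ; homo   = λ _ _ _ → ≈.refl B
    }

  presented-eval : ∀ {B} {Γ : Pred (Equation X) 0ℓ} {h} → IsHomomorphism (presented Γ) B h →
                   ∀ t → Algebra._≈_ B (h (lift t)) (eval B (h ∘ lift ∘ var) t)
  presented-eval {B = B} H (var x)     = ≈.refl B
  presented-eval {B = B} H ε           = IsHomomorphism.e-homo H
  presented-eval {B = B} H (app o s t) = ≈.trans B (IsHomomorphism.homo H o _ _)
    (Algebra.op-cong B o (presented-eval H s) (presented-eval H t))

  presented-free : ∀ n → IsFree 𝒱 n (presented ∅) (lift ∘ var)
  presented-free n = record
    { member = presented-∈ ∅
    ; extend = λ A A∈𝒱 g →
        eval A g ∘ lower , presented-extend A∈𝒱 g (λ ()) , λ _ → ≈.refl A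
    ; unique = λ A A∈𝒱 H K eq (lift t) → ≈.trans A (presented-eval H t)
        (≈.trans A (eval-cong A eq t) (≈.sym A (presented-eval K t)))
    }

  presented-finitelyPresented : ∀ n R →
    FinitelyPresented 𝒱 (quotient (presented {X = Fin n} ∅) R)
  presented-finitelyPresented n R =
    n , presented ∅ , lift ∘ var , presented-free n , R ,
    id , id-homo _ , id , λ y → y , id

  -- The composite of `F` into the term algebra and back by evaluation fixes the generators, so it
  -- is the identity; the first map picks the term.
  free⇒term : ∀ {n F x} → IsFree 𝒱 n F x →
              ∀ a → ∃[ t ] Algebra._≈_ F a (eval F x t)
  free⇒term {n} {F} {x} free a = lower (f a) ,
    ≈.sym F (unique F member (∘-homo X-homo f-homo) (id-homo F) fixes a)
    where
    open IsFree free
    to-terms = extend (presented {X = Fin n} ∅) (presented-∈ ∅) (lift ∘ var)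
    f = proj₁ to-terms
    f-homo = proj₁ (proj₂ to-terms)
    X-homo : IsHomomorphism (presented ∅) F (eval F x ∘ lower)
    X-homo = presented-extend member x (λ ())
    fixes : ∀ i → Algebra._≈_ F (eval F x (lower (f (x i)))) (x i)
    fixes i = IsHomomorphism.cong X-homo (proj₂ (proj₂ to-terms) i)

  -- Finite presentability does not depend on the choice of generators: the relations
  -- of the given presentation, rewritten in terms of g, hold at a finite stage of Γ.
  finitelyPresented-compact :
    ∀ {G} → FinitelyPresented 𝒱 G →
    ∀ {r} (g : Fin r → Algebra.Carrier G) →
    (∀ a → ∃[ t ] Algebra._≈_ G a (eval G g t)) →
    (Γ : ℕ → Pred (Equation (Fin r)) 0ℓ) → (∀ {i j} → i ≤ₙ j → Γ i ⊆ Γ j) →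
    (∀ {s t} → Satisfies G g (s , t) → ⋃ ℕ Γ ⊢ s ≋ t) →
    ∃[ k ] ∀ {s t} → Satisfies G g (s , t) → Γ k ⊢ s ≋ t
  finitelyPresented-compact {G} (n , F , x , free , R , h , H , injective , surjective)
                            {r} g generated Γ mono complete = k , holds
    where
    module F = Algebra F
    module H = Homomorphism H
    open Algebra G using (_≈_)
    open IsFree free

    F/R = quotient F R
    term = free⇒term free

    -- `b` carries the generators of the given presentation over to `G`, and `τ` expresses them
    -- through `g`.
    b : Fin n → Algebra.Carrier G
    b i = proj₁ (surjective (x i))
    τ : Fin n → Term (Fin r)
    τ i = proj₁ (generated (b i))

    F/R-eval : ∀ p → Algebra._≈_ F/R (h (eval G b p)) (eval F x p)
    F/R-eval p = begin
      h (eval G b p)         ≈⟨ H.eval-homo b p ⟩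
      eval F/R (h ∘ b) p     ≈⟨ eval-cong F/R (λ i → proj₂ (surjective (x i)) (≈.refl G)) p ⟩
      eval F/R x p           ≈⟨ Homomorphism.eval-homo (quotient-homo F R) x p ⟨
      eval F x p             ∎
      where open SetoidReasoning (≈.setoid F/R)

    b-eval : ∀ p → eval G b p ≈ eval G g (p [ τ ])
    b-eval p = begin
      eval G b p                 ≈⟨ eval-cong G (λ i → proj₂ (generated (b i))) p ⟩
      eval G (eval G g ∘ τ) p    ≡⟨ eval-[] G g τ p ⟨
      eval G g (p [ τ ])         ∎
      where open SetoidReasoning (≈.setoid G)

    relation : F.Carrier × F.Carrier → Equation (Fin r)
    relation (y , z) = proj₁ (term y) [ τ ] , proj₁ (term z) [ τ ]

    relation-holds : ∀ {yz} → yz ∈ₗ R → Satisfies G g (relation yz)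
    relation-holds {y , z} yz∈R = ≈.trans G (≈.sym G (b-eval p)) (≈.trans G
      (injective (begin
        h (eval G b p)   ≈⟨ F/R-eval p ⟩
        eval F x p       ≈⟨ Cg-refl (proj₂ (term y)) ⟨
        y                ≈⟨ Cg-gen yz∈R ⟩
        z                ≈⟨ Cg-refl (proj₂ (term z)) ⟩
        eval F x q       ≈⟨ F/R-eval q ⟨
        h (eval G b q)   ∎))
      (b-eval q))
      where
      open SetoidReasoning (≈.setoid F/R)
      p = proj₁ (term y)
      q = proj₁ (term z)

    -- The rewritten relations alone do not suffice: each `g i` must also be tied to its own
    -- expression through the old generators, rewritten by `τ`.
    generator : Fin r → Equation (Fin r)
    generator i = var i , proj₁ (term (h (g i))) [ τ ]

    generator-holds : ∀ i → Satisfies G g (generator i)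
    generator-holds i = ≈.trans G
      (injective (≈.trans F/R (Cg-refl (proj₂ (term (h (g i)))))
                              (≈.sym F/R (F/R-eval p))))
      (b-eval p)
      where
      p = proj₁ (term (h (g i)))

    Stage : ℕ → Pred (Equation (Fin r)) _
    Stage k (s , t) = Γ k ⊢ s ≋ t

    stage : ∀ eq → Satisfies G g eq → ∃[ k ] eq ∈ Stage k
    stage _ = ≋-compact mono ∘ complete

    relations = All-stage {P = λ k yz → relation yz ∈ Stage k}
      (λ i≤j → ≋-weaken (mono i≤j))
      (All.tabulate {xs = R} λ yz∈R → stage _ (relation-holds yz∈R))
    generators = All-stage {P = λ k i → generator i ∈ Stage k}
      (λ i≤j → ≋-weaken (mono i≤j))
      (All.tabulate {xs = allFin r} λ {i} _ → stage _ (generator-holds i))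

    k : ℕ
    k = proj₁ relations ⊔ₙ proj₁ generators

    Q = presented (Γ k)
    open Algebra Q using () renaming (_≈_ to _≈Q_)

    relation-stage : ∀ {yz} → yz ∈ₗ R → relation yz ∈ Stage k
    relation-stage yz∈R =
      ≋-weaken (mono (m≤m⊔n _ _)) (All.lookup (proj₂ relations) yz∈R)

    generator-stage : ∀ i → generator i ∈ Stage k
    generator-stage i =
      ≋-weaken (mono (m≤n⊔m (proj₁ relations) _)) (All.lookup (proj₂ generators) (∈-allFin i))

    -- The old generators go to their expressions `τ`. The relations in `R` hold among these at
    -- stage `k`, so the map factors through `F/R`.
    extension = extend Q (presented-∈ (Γ k)) (lift ∘ τ)
    q = proj₁ extension
    module q = Homomorphism (proj₁ (proj₂ extension))

    q-eval : ∀ y → q y ≈Q lift (proj₁ (term y) [ τ ])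
    q-eval y = begin
      q y                      ≈⟨ q.h-cong (proj₂ (term y)) ⟩
      q (eval F x p)           ≈⟨ q.eval-homo x p ⟩
      eval Q (q ∘ x) p         ≈⟨ eval-cong Q (proj₂ (proj₂ extension)) p ⟩
      eval Q (lift ∘ τ) p      ≡⟨ eval-presented (Γ k) (lift ∘ τ) p ⟩
      lift (p [ τ ])           ∎
      where
      open SetoidReasoning (≈.setoid Q)
      p = proj₁ (term y)

    q-homo : IsHomomorphism F/R Q q
    q-homo = q.quotient-extend λ {y} {z} yz∈R →
      ≈.trans Q (q-eval y) (≈.trans Q (relation-stage yz∈R) (≈.sym Q (q-eval z)))

    φ : Algebra.Carrier G → Algebra.Carrier Q
    φ = q ∘ h
    module φ = Homomorphism (∘-homo q-homo H)

    -- `φ` undoes evaluation at `g`, so terms with equal values in `G` are provably equal at stage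
    -- `k`.
    φ-eval : ∀ s → φ (eval G g s) ≈Q lift s
    φ-eval s = begin
      φ (eval G g s)           ≈⟨ φ.eval-homo g s ⟩
      eval Q (φ ∘ g) s         ≈⟨ eval-cong Q (λ i → ≈.trans Q (q-eval (h (g i)))
                                                    (≈.sym Q (generator-stage i))) s ⟩
      eval Q (lift ∘ var) s    ≡⟨ eval-presented (Γ k) (lift ∘ var) s ⟩
      lift (s [ var ])         ≡⟨ cong lift ([]-var s) ⟩
      lift s                   ∎
      where open SetoidReasoning (≈.setoid Q)

    holds : ∀ {s t} → Satisfies G g (s , t) → Γ k ⊢ s ≋ t
    holds {s} {t} p = ≈.trans Q (≈.sym Q (φ-eval s)) (≈.trans Q (φ.h-cong p) (φ-eval t))

-- Canonical extensions

module Canonical {A : Algebra ℓ} (rl : IsResiduatedLattice A)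
                 (C : CanonicalExtension (IsResiduatedLattice.poset rl)) where
  open Algebra A
  open ResiduatedLattice rl using (antisym; ≤-rfl; ≤-reflexive)
  private
    module C = CanonicalExtension C
  open C using (ι; IsOpen; IsClosed; ⋀′; ⋁′; _^σ; _^π)
  open IsOrderMonomorphism C.ι-embedding public
    renaming (cong to ι-cong; mono to ι-mono; injective to ι-injective; cancel to ι-cancel)

  ⋀′-lower : ∀ {S : Pred C.Carrier ℓ} {z} → z ∈ S → ⋀′ S C.≤ z
  ⋀′-lower z∈S = proj₁ (C.⋀-inf _) _ (lift z∈S)

  ⋀′-greatest : ∀ {S : Pred C.Carrier ℓ} {z} → (∀ {y} → y ∈ S → z C.≤ y) → z C.≤ ⋀′ S
  ⋀′-greatest z≤S = proj₂ (C.⋀-inf _) _ λ _ p → z≤S (lower p)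

  ⋁′-upper : ∀ {S : Pred C.Carrier ℓ} {z} → z ∈ S → z C.≤ ⋁′ S
  ⋁′-upper z∈S = proj₁ (C.⋁-sup _) _ (lift z∈S)

  ⋁′-least : ∀ {S : Pred C.Carrier ℓ} {z} → (∀ {y} → y ∈ S → y C.≤ z) → ⋁′ S C.≤ z
  ⋁′-least S≤z = proj₂ (C.⋁-sup _) _ λ _ p → S≤z (lower p)

  ι-closed : ∀ a → IsClosed (ι a)
  ι-closed a = (_≡ a) , (a , ≡-refl) ,
    (λ { y (_ , ≡-refl , y≈ιa) → C.reflexive (C.Eq.sym y≈ιa) }) ,
    λ z z≤ → z≤ _ (a , ≡-refl , C.Eq.refl)

  ι-open : ∀ a → IsOpen (ι a)
  ι-open a = (_≡ a) , (a , ≡-refl) ,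
    (λ { y (_ , ≡-refl , y≈ιa) → C.reflexive y≈ιa }) ,
    λ z ≤z → ≤z _ (a , ≡-refl , C.Eq.refl)

  between-ι : ∀ {a b} → ι a C.≤ ι b × ι b C.≤ ι a → a ≈ b
  between-ι (p , q) = antisym (ι-cancel p) (ι-cancel q)

  -- Elements of the lattice are both closed and open, so they can serve as their own bounds on
  -- either side.
  at-ι : ∀ {val : (p₁ p₂ q₁ q₂ : C.Carrier) → C.Carrier} a b →
         C.Approximants val (ι a) (ι b) (val (ι a) (ι b) (ι a) (ι b))
  at-ι a b = record
    { closed₁  = ι-closed a
    ; closed₂  = ι-closed b
    ; open₁    = ι-open a
    ; open₂    = ι-open b
    ; between₁ = C.refl , C.refl
    ; between₂ = C.refl , C.refl
    ; value    = C.Eq.refl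
    }

  module _ {f : Carrier → Carrier → Carrier}
           (f-cong : ∀ {x x′ y y′} → x ≈ x′ → y ≈ y′ → f x y ≈ f x′ y′) where

    -- With `ι a` and `ι b` as their own bounds, `f a b` is the only value. All other bounds admit
    -- `f a b` among their values, so their meet is no larger.
    σ-extends : ∀ a b → ι (f a b) C.≈ (f ^σ) (ι a) (ι b)
    σ-extends a b = C.antisym
      (C.trans
        (⋀′-greatest λ (_ , _ , in₁ , in₂ , z≈) →
          C.reflexive (C.Eq.trans (ι-cong (f-cong (between-ι in₁) (between-ι in₂)))
                                  (C.Eq.sym z≈)))
        (proj₁ (C.⋁-sup _) _ (at-ι a b)))
      (proj₂ (C.⋁-sup _) _ λ y I → let open C.Approximants I in
        C.trans (C.reflexive value) (⋀′-lower (a , b , between₁ , between₂ , C.Eq.refl)))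

    π-extends : ∀ a b → ι (f a b) C.≈ (f ^π) (ι a) (ι b)
    π-extends a b = C.antisym
      (proj₂ (C.⋀-inf _) _ λ y I → let open C.Approximants I in
        C.trans (⋁′-upper (a , b , between₁ , between₂ , C.Eq.refl))
                (C.reflexive (C.Eq.sym value)))
      (C.trans
        (proj₁ (C.⋀-inf _) _ (at-ι a b))
        (⋁′-least λ (_ , _ , in₁ , in₂ , z≈) →
          C.reflexive (C.Eq.trans z≈ (C.Eq.sym
            (ι-cong (f-cong (between-ι in₁) (between-ι in₂)))))))

  ι-homo : IsHomomorphism A (canonicalAlgebra A rl C) ι
  ι-homo = record { cong = ι-cong ; e-homo = C.Eq.refl ; homo = extends }
    where
    extends : ∀ o a b →
              ι (op o a b) C.≈ Algebra.op (canonicalAlgebra A rl C) o (ι a) (ι b)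
    extends meet  = σ-extends (op-cong meet)
    extends join  = σ-extends (op-cong join)
    extends mult  = σ-extends (op-cong mult)
    extends under = π-extends (op-cong under)
    extends over  = π-extends (op-cong over)

  -- Limits of descending chains

  module Chain (c : ℕ → Carrier) (antitone : ∀ {i j} → i ≤ₙ j → c j ≤ c i) where

    terms : Pred C.Carrier ℓ
    terms z = ∃[ k ] z ≡ ι (c k)

    limit : C.Carrier
    limit = ⋀′ terms

    limit-lower : ∀ k → limit C.≤ ι (c k)
    limit-lower k = ⋀′-lower (k , ≡-refl)

    limit-greatest : ∀ {z} → (∀ k → z C.≤ ι (c k)) → z C.≤ limit
    limit-greatest z≤ = ⋀′-greatest λ { (k , ≡-refl) → z≤ k }

    limit-closed : IsClosed limit
    limit-closed = (λ a → Lift ℓ (∃[ k ] a ≡ c k)) , (c 0 , lift (0 , ≡-refl)) ,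
      (λ { y (_ , lift (k , ≡-refl) , y≈) →
           C.trans (limit-lower k) (C.reflexive (C.Eq.sym y≈)) }) ,
      λ z z≤ → limit-greatest λ k → z≤ _ (c k , lift (k , ≡-refl) , C.Eq.refl)

    -- Compactness, applied to the chain and the singleton of `q`, gives finitely many terms of the
    -- chain with meet below `q`; a term of large enough index lies below all of them.
    limit-compact : ∀ {q} → IsOpen q → limit C.≤ q → ∃[ k ] ι (c k) C.≤ q
    limit-compact {q} q-open limit≤q = k ,
      C.trans (⋀′-greatest λ y∈A₀ →
                 All.lookupWith (λ p y≈ → C.trans p (C.reflexive (C.Eq.sym y≈))) below y∈A₀)
      (C.trans ⋀A₀≤⋁B₀
              (⋁′-least λ {y} y∈B₀ →
                 All.lookupWith {R = λ _ → y C.≤ q}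
                   (λ { (lift ≡-refl) y≈ → C.reflexive y≈ }) B₀⊆ y∈B₀))
      where
      compactness = Equivalence.to
        (C.compact (λ z → Lift (lsuc ℓ) (terms z)) (λ z → Lift (lsuc ℓ) (z ≡ q))
          (λ { (lift (k , ≡-refl)) → ι-closed (c k) }) (λ { (lift ≡-refl) → q-open })
          (ι (c 0) , lift (0 , ≡-refl)) (q , lift ≡-refl))
        (C.trans limit≤q (proj₁ (C.⋁-sup _) q (lift ≡-refl)))
      A₀⊆ = proj₁ (proj₂ compactness)
      B₀⊆ = proj₁ (proj₂ (proj₂ compactness))
      ⋀A₀≤⋁B₀ = proj₂ (proj₂ (proj₂ compactness))
      bound = All-stage {P = λ k z → ι (c k) C.≤ z}
        (λ i≤j → C.trans (ι-mono (antitone i≤j)))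
        (All.map (λ { (lift (k , ≡-refl)) → k , C.refl }) A₀⊆)
      k = proj₁ bound
      below = proj₂ bound

    module _ {f : Carrier → Carrier → Carrier}
             (f-cong : ∀ {x x′ y y′} → x ≈ x′ → y ≈ y′ → f x y ≈ f x′ y′)
             (f-monoʳ : ∀ a {b b′} → b ≤ b′ → f a b ≤ f a b′) where

      -- `f ^σ` commutes with the limit in its second argument. The infimum `z` is given by its
      -- universal property, so that a lattice element or the limit itself can be supplied for it.
      σ-limit : ∀ {a z} → (∀ k → z C.≤ ι (f a (c k))) →
                (∀ {y} → (∀ k → y C.≤ ι (f a (c k))) → y C.≤ z) →
                z C.≈ (f ^σ) (ι a) limit
      σ-limit {a} {z} z-lower z-greatest = C.antisym
        (C.trans
          -- `ι a₂` is open and above the limit, hence above some `c k`.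
          (⋀′-greatest λ (a₁ , a₂ , in₁ , (limit≤ , _) , y≈) →
            let (k , ck≤a₂) = limit-compact (ι-open a₂) limit≤ in
            C.trans (z-lower k) (C.trans (ι-mono (f-monoʳ a (ι-cancel ck≤a₂)))
              (C.reflexive (C.Eq.trans
                (ι-cong (f-cong (between-ι in₁) (≈.refl A))) (C.Eq.sym y≈)))))
          (proj₁ (C.⋁-sup _) _ approximant))
        (proj₂ (C.⋁-sup _) _ λ y I → let open C.Approximants I in
          -- The open bound lies above some `c j`. The later term `c (k ⊔ₙ j)` is then within the
          -- bounds, and `f a` takes it below `f a (c k)`.
          C.trans (C.reflexive value) (z-greatest λ k →
            let (j , cj≤q₂) = limit-compact open₂ (proj₂ between₂)
                c⊔ = c (k ⊔ₙ j)
            in C.trans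
                 (⋀′-lower (a , c⊔ , between₁ ,
                    (C.trans (proj₁ between₂) (limit-lower (k ⊔ₙ j)) ,
                     C.trans (ι-mono (antitone (m≤n⊔m k j))) cj≤q₂) , C.Eq.refl))
                 (ι-mono (f-monoʳ a (antitone (m≤m⊔n k j))))))
        where
        -- An open element above the limit is required; the first term of the chain serves.
        approximant : C.Approximants (λ p₁ p₂ q₁ q₂ → ⋀′ (C.values f p₁ p₂ q₁ q₂)) (ι a) limit
                        (⋀′ (C.values f (ι a) limit (ι a) (ι (c 0))))
        approximant = record
          { closed₁  = ι-closed a
          ; closed₂  = limit-closed
          ; open₁    = ι-open a
          ; open₂    = ι-open (c 0)
          ; between₁ = C.refl , C.refl
          ; between₂ = C.refl , limit-lower 0
          ; value    = C.Eq.refl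
          }

-- Coherence and the powers of `e ∧ u`

module Coherent {ℓ v w} (𝒱 : Class ℓ v) (𝒞 : Class ℓ w) (𝒱≐ISP : 𝒱 ≐ ISP 𝒞)
                (variety : IsVariety 𝒱) (residuated : 𝒱 ⊆ IsResiduatedLattice)
                (coherent : IsCoherent 𝒱) (canonical : ClosedUnderCanonicalExtensions 𝒞)
                where
  open Variety 𝒱 variety

  𝒞⊆𝒱 : 𝒞 ⊆ 𝒱
  𝒞⊆𝒱 C∈𝒞 = proj₂ 𝒱≐ISP (⊆ISP 𝒞 C∈𝒞)

  bound : ℕ → Equation (Fin 2)
  bound j = var 1F ≈̇ var 1F ∧̇ ((ε ∧̇ var 0F) ^̇ j)

  -- All bounds up to `k` are included, so that the stages increase as sets of equations.
  Γ : ℕ → Pred (Equation (Fin 2)) 0ℓ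
  Γ k eq = ∃[ j ] j ≤ₙ k × eq ≡ bound j

  Γ-mono : ∀ {i j} → i ≤ₙ j → Γ i ⊆ Γ j
  Γ-mono i≤j (l , l≤i , eq) = l , ≤-trans l≤i i≤j , eq

  F : Algebra ℓ
  F = presented {X = Fin 3} ∅

  -- The variables 0, 1, 2 are u, y, x. The element x encodes infinitely many bounds on y by three
  -- relations.
  R : List (Algebra.Carrier F × Algebra.Carrier F)
  R = (lift (var 1F) , lift (var 1F ∧̇ var 2F))
    ∷ (lift (var 2F) , lift (ε ∧̇ var 2F))
    ∷ (lift (var 2F) , lift ((ε ∧̇ var 0F) ·̇ var 2F))
    ∷ []

  A : Algebra ℓ
  A = quotient F R

  A∈𝒱 : A ∈ 𝒱
  A∈𝒱 = quotient-∈ (presented-∈ ∅) R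

  xs : List (Algebra.Carrier A)
  xs = lift (var 0F) ∷ lift (var 1F) ∷ []

  A-bound : ∀ j → Satisfies A (lookup xs) (bound j)
  A-bound j = subst (y ≤_) (≡-sym (eval-^ (lookup xs) (ε ∧̇ var 0F) j)) (≤-trn y≤z (z≤c^ j))
    where
    open Algebra A
    open ResiduatedLattice (residuated A∈𝒱)
    open Powers A
    y z : Carrier
    y = lift (var 1F)
    z = lift (var 2F)
    y≤z : y ≤ z
    y≤z = Cg-gen (here ≡-refl)
    z≤c^ : ∀ j → z ≤ (e ∧ lift (var 0F)) ^ j
    z≤c^ zero    = ≤-trn (≤-reflexive (Cg-gen (there (here ≡-refl)))) (x∧y≤x e z)
    -- The third relation replaces `z` by `c · z`, which the induction hypothesis bounds by
    -- `c · cʲ`.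
    z≤c^ (suc j) = ≤-trn (≤-reflexive (Cg-gen (there (there (here ≡-refl)))))
                         (·-monoʳ _ (z≤c^ j))

  module _ {B : Algebra ℓ} (B∈𝒞 : B ∈ 𝒞) where
    open Algebra B

    -- `B` may lack a value for the third generator, but its canonical extension has the limit of
    -- the powers of `c`. Thus `A` maps into the extension, and the embedding of `B` reflects
    -- equations between terms in the first two generators.
    A⇒B : (ρ : Fin 2 → Carrier) → (∀ j → Satisfies B ρ (bound j)) →
          ∀ s t → Satisfies A (lookup xs) (s , t) → Satisfies B ρ (s , t)
    A⇒B ρ bounds s t p = Homomorphism.reflects ι-homo ρ s t ι-injective
      (≈.trans Bσ (≈.sym Bσ (eval-cong Bσ ψ-lookup s))
        (≈.trans Bσ (Homomorphism.preserves ψ-homo (lookup xs) s t p) (eval-cong Bσ ψ-lookup t)))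
      where
      rl = residuated (𝒞⊆𝒱 B∈𝒞)
      C = proj₁ (canonical B rl B∈𝒞)
      module C = CanonicalExtension C
      open Canonical rl C
      open ResiduatedLattice rl
      open Powers B

      Bσ : Algebra ℓ
      Bσ = canonicalAlgebra B rl C

      c y : Carrier
      c = e ∧ ρ 0F
      y = ρ 1F

      c≤e : c ≤ e
      c≤e = x∧y≤x e (ρ 0F)

      y≤c^ : ∀ j → y ≤ c ^ j
      y≤c^ j = subst (y ≤_) (eval-^ ρ (ε ∧̇ var 0F) j) (bounds j)

      open Chain (c ^_) (^-antitone c≤e)

      ψ : Fin 3 → C.Carrier
      ψ 0F = C.ι (ρ 0F)
      ψ 1F = C.ι (ρ 1F)
      ψ 2F = limit

      R-holds : ∀ {a b} → (a , b) ∈ₗ R → eval Bσ ψ (lower a) C.≈ eval Bσ ψ (lower b)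
      -- Every `y ∧ cᵏ` equals `y`, so `ι y` is their infimum.
      R-holds (here ≡-refl) = σ-limit (op-cong meet) ∧-monoʳ
        (λ k → ι-mono (∧-greatest ≤-rfl (y≤c^ k)))
        (λ z≤ → C.trans (z≤ 0) (ι-mono (x∧y≤x _ _)))
      R-holds (there (here ≡-refl)) = σ-limit (op-cong meet) ∧-monoʳ
        (λ k → C.trans (limit-lower k)
                       (ι-mono (∧-greatest (^-antitone c≤e {j = k} z≤n) ≤-rfl)))
        (λ z≤ → limit-greatest λ k → C.trans (z≤ k) (ι-mono (x∧y≤y _ _)))
      -- Multiplying by `c` shifts the chain by one index and keeps its infimum. The last line
      -- rewrites `ι c` as a meet in the extension.
      R-holds (there (there (here ≡-refl))) = C.Eq.trans
        (σ-limit (op-cong mult) ·-monoʳ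
          (λ k → limit-lower (suc k))
          (λ z≤ → limit-greatest λ k → C.trans (z≤ k) (ι-mono (·-decreasing c≤e _))))
        (Algebra.op-cong Bσ mult (IsHomomorphism.homo ι-homo meet e (ρ 0F)) C.Eq.refl)

      ψ-homo : IsHomomorphism A Bσ (eval Bσ ψ ∘ lower)
      ψ-homo = Homomorphism.quotient-extend
        (presented-extend (𝒞⊆𝒱 (proj₂ (canonical B rl B∈𝒞))) ψ (λ ())) R-holds

      ψ-lookup : ∀ i → eval Bσ ψ (lower (lookup xs i)) C.≈ C.ι (ρ i)
      ψ-lookup 0F = C.Eq.refl
      ψ-lookup 1F = C.Eq.refl

  -- The algebra presented by all the bounds embeds into a product of members of `𝒞`. Each
  -- coordinate satisfies the bounds, so `A⇒B` applies there, and injectivity assembles the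
  -- coordinates.
  A⇒⊢ : ∀ {s t} → Satisfies A (lookup xs) (s , t) → ⋃ ℕ Γ ⊢ s ≋ t
  A⇒⊢ {s} {t} p =
    let (I , B , B∈𝒞 , S , sub , h , H , injective , _) =
          proj₁ 𝒱≐ISP (presented-∈ (⋃ ℕ Γ))
        φ-homo i = ∘-homo (evaluation-homo B i) (∘-homo (proj₁-homo (product I B) sub) H)
        bounds i j = ≈.trans (B i)
          (IsHomomorphism.cong (φ-homo i) (≋-hyp (j , j , ≤-refl , ≡-refl)))
          (presented-eval (φ-homo i) (proj₂ (bound j)))
    in injective λ i → ≈.trans (B i) (presented-eval (φ-homo i) s)
         (≈.trans (B i) (A⇒B (B∈𝒞 i) _ (bounds i) s t p)
                        (≈.sym (B i) (presented-eval (φ-homo i) t)))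

  G : Algebra ℓ
  G = generatedSubalgebra A xs

  g : Fin 2 → Algebra.Carrier G
  g i = lookup xs i , Sg-gen (∈-lookup i)

  module G⇒A = Homomorphism (proj₁-homo A (Sg-isSubuniverse A xs))

  G-generated : ∀ a → ∃[ t ] Algebra._≈_ G a (eval G g t)
  G-generated (a , a∈G) =
    let (t , eq) = Sg⇒term A xs a∈G in t , ≈.trans A eq (≈.sym A (G⇒A.eval-homo g t))

  -- Coherence enters here: `G` is finitely presented, and all its equations follow from the union
  -- of the stages, hence from one of them.
  finite-stage : ∃[ n ] ∀ {s t} → Satisfies G g (s , t) → Γ n ⊢ s ≋ t
  finite-stage = finitelyPresented-compact
    (coherent A A∈𝒱 (presented-finitelyPresented 3 R) xs)
    g G-generated Γ Γ-mono λ {s} {t} p → A⇒⊢ (G⇒A.preserves g s t p)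

  stable : ∃[ n ] 𝒱 ⊨ (ε ∧̇ x̂) ^̇ (suc n) ≈̇ (ε ∧̇ x̂) ^̇ n
  stable = n , λ M M∈𝒱 ρ →
    let open Algebra M
        open ResiduatedLattice (residuated M∈𝒱)
        open Powers M
        c = e ∧ ρ 0
        c≤e = x∧y≤x e (ρ 0)
        -- `c ^ n` is the largest value of y allowed by the bounds up to `n`; the bound at `suc n`
        -- then reads `c ^ n ≤ c ^ suc n`.
        θ = lookup (ρ 0 ∷ c ^ n ∷ [])
        Γ-holds : ∀ {s t} → (s , t) ∈ Γ n → Satisfies M θ (s , t)
        Γ-holds = λ { (j , j≤n , ≡-refl) →
          subst (c ^ n ≤_) (≡-sym (eval-^ θ (ε ∧̇ var 0F) j)) (^-antitone c≤e j≤n) }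
        c^n≤c^1+n : c ^ n ≤ c ^ suc n
        c^n≤c^1+n = subst (c ^ n ≤_) (eval-^ θ (ε ∧̇ var 0F) (suc n))
                          (sound M∈𝒱 θ Γ-holds Γ⊢bound)
    in subst (λ z → c · z ≈ z) (≡-sym (eval-^ ρ (ε ∧̇ x̂) n))
             (antisym (·-decreasing c≤e (c ^ n)) c^n≤c^1+n)
    where
    n = proj₁ finite-stage
    -- The next bound holds in `A`, hence in `G`, and so is derivable from stage `n`.
    Γ⊢bound : Γ n ⊢ proj₁ (bound (suc n)) ≋ proj₂ (bound (suc n))
    Γ⊢bound = proj₂ finite-stage
      (G⇒A.reflects g (var 1F) (proj₂ (bound (suc n))) id (A-bound (suc n)))

theorem5p10 : {ℓ v w : Level} (𝒱 : Class ℓ v) (𝒞 : Class ℓ w) →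
    𝒱 ≐ ISP 𝒞 →
    IsVariety 𝒱 →
    𝒱 ⊆ IsResiduatedLattice →
    IsCoherent 𝒱 →
    ClosedUnderCanonicalExtensions 𝒞 →
    (∃[ n ] 𝒱 ⊨ (ε ∧̇ x̂) ^̇ (suc n) ≈̇ (ε ∧̇ x̂) ^̇ n) ×
    (IsHamiltonian 𝒱 → HasEDPC 𝒱)
theorem5p10 𝒱 𝒞 𝒱≐ISP variety residuated coherent canonical =
  stable , hamiltonian⇒EDPC residuated (proj₁ stable) (proj₂ stable)
  where
  open Coherent 𝒱 𝒞 𝒱≐ISP variety residuated coherent canonical using (stable)
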